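{- Let $h_2:\{0,1,2,3\}^*\to\{0,1,2\}^*$ be the morphism defined by $$h_2(0)=00021,\quad h_2(1)=00111,\quad h_2(2)=01121,\quad h_2(3)=01221.$$ Then $h_2$ is $(2,2)$-abelian-square-free; that is, for every abelian-square-free word $w$ over $\{0,1,2,3\}$, the word $h_2(w)$ has no factor which is a $2$-abelian-square of period at least $2$.
   Context: For finite words $u,w$, $|u|_w$ denotes the number of occurrences of $w$ as a factor of $u$. For $k\ge 1$, two finite words $u,v$ are $k$-abelian equivalent if $|u|_w=|v|_w$ for every non-empty word $w$ with $|w|\le k$. A $k$-abelian-square is a non-empty word $u_1u_2$ with $u_1$ and $u_2$ $k$-abelian equivalent; its period is $|u_1|$. For $k=1$ one says simply abelian equivalent and abelian-square. A word is abelian-square-free if none of its factors is an abelian-square. A morphism $h$ is $(p,k)$-abelian-square-free if for every abelian-square-free word $w$, $h(w)$ avoids (contains no factor that is) $k$-abelian-squares of period at least $p$. -}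

module Defs where

open import Data.Fin using (Fin; #_; _≟_)
open import Data.List using (List; []; _∷_; _++_; length; filter; tails; concatMap)
open import Data.List.Relation.Binary.Infix.Heterogeneous using (Infix)
open import Data.List.Relation.Binary.Prefix.Heterogeneous.Properties using (prefix?)
open import Data.Nat using (ℕ; _≤_)
open import Relation.Binary.PropositionalEquality using (_≡_; _≢_)
open import Relation.Nullary using (¬_)

Word : ℕ → Set
Word n = List (Fin n)

Factor : ∀ {n} → Word n → Word n → Set
Factor = Infix _≡_

-- Occurrences of w in u (possibly overlapping), one for each suffix of u
-- that begins with w.
occurrences : ∀ {n} → Word n → Word n → ℕ
occurrences u w = length (filter (prefix? _≟_ w) (tails u))

AbelianEquivalent : ∀ {n} → ℕ → Word n → Word n → Set
AbelianEquivalent {n} k u v =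
  (w : Word n) → w ≢ [] → length w ≤ k → occurrences u w ≡ occurrences v w

record AbelianSquare {n : ℕ} (k : ℕ) (s : Word n) : Set where
  field
    u₁ u₂      : Word n
    split      : s ≡ u₁ ++ u₂
    nonEmpty   : s ≢ []
    equivalent : AbelianEquivalent k u₁ u₂

  period : ℕ
  period = length u₁

AbelianSquareFree : ∀ {n} → Word n → Set
AbelianSquareFree {n} w = (s : Word n) → Factor s w → ¬ AbelianSquare 1 s

AvoidsAbelianSquares : ∀ {n} → ℕ → ℕ → Word n → Set
AvoidsAbelianSquares {n} p k w =
  (s : Word n) → Factor s w →
  (sq : AbelianSquare k s) → ¬ (p ≤ AbelianSquare.period sq)

-- A morphism of free monoids is given by the images of the letters.
Morphism : ℕ → ℕ → Set
Morphism m n = Fin m → Word n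

apply : ∀ {m n} → Morphism m n → Word m → Word n
apply = concatMap

AbelianSquareFreeMorphism : ∀ {m n} → ℕ → ℕ → Morphism m n → Set
AbelianSquareFreeMorphism {m} p k h =
  (w : Word m) → AbelianSquareFree w → AvoidsAbelianSquares p k (apply h w)

h₂ : Morphism 4 3
h₂ Fin.zero                               = # 0 ∷ # 0 ∷ # 0 ∷ # 2 ∷ # 1 ∷ []
h₂ (Fin.suc Fin.zero)                     = # 0 ∷ # 0 ∷ # 1 ∷ # 1 ∷ # 1 ∷ []
h₂ (Fin.suc (Fin.suc Fin.zero))           = # 0 ∷ # 1 ∷ # 1 ∷ # 2 ∷ # 1 ∷ []
h₂ (Fin.suc (Fin.suc (Fin.suc Fin.zero))) = # 0 ∷ # 1 ∷ # 2 ∷ # 2 ∷ # 1 ∷ []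

-- Cut u₁ and u₂ at the block boundaries of h₂ w: u₁ = S · h₂(w₁) · P and
-- u₂ = S′ · h₂(w₂) · Q, where P S′ is the image of the letter in which u₁ ends.
-- Suitable integer combinations of 2-letter factor counts read off the number
-- of occurrences of each letter t in a preimage, so the partial blocks S, P, S′, Q
-- determine the difference of the Parikh vectors of w₁ and w₂.  A finite
-- check over all partial blocks shows that this difference always becomes
-- zero after moving the three boundary letters to suitable sides, which gives an
-- abelian-square in w.  Since the factor 10 occurs exactly at the joins of blocks,
-- u₁ and u₂ meet the same number of joins, which handles the short cases.
module Submission where

open import Defs
open import Data.Empty using (⊥)
open import Data.Fin using (Fin; zero; suc; toℕ; fromℕ<; inject₁; #_) renaming (_≟_ to _≟ᶠ_)
open import Data.Fin.Properties using (all?; any?; toℕ-fromℕ<; toℕ-inject₁)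
open import Data.Integer using (ℤ; +_; -[1+_]; _+_; _*_; _≟_)
open import Data.Integer.Properties using (+-assoc; +-identityˡ; +-injective; pos-+; +-0-abelianGroup)
open import Data.Integer.Tactic.RingSolver using (solve-∀)
open import Data.List using (List; []; _∷_; _++_; _∷ʳ_; length; take; drop)
open import Data.List.Properties
  using (take++drop≡id; ∷-injective; ++-assoc; ++-identityʳ; ++-conicalˡ; ++-conicalʳ; ++-monoid;
         length-++; length-drop)
open import Data.List.Relation.Binary.Infix.Heterogeneous using (View; MkView; toView; fromView)
open import Data.List.Relation.Binary.Pointwise using (Pointwise-≡⇒≡) renaming (refl to Pointwise-refl)
open import Data.Nat as ℕ using (ℕ; _≤_; _<_; z≤n; s≤s; _≤?_)
import Data.Nat.Properties as ℕ
open import Data.Product using (_×_; _,_; ∃-syntax)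
open import Data.Sum using (_⊎_; inj₁; inj₂)
open import Relation.Binary.PropositionalEquality
open import Relation.Nullary.Decidable using (Dec; from-yes; _→-dec_; ¬?)
open import Relation.Nullary using (contradiction; yes; no)
open import Tactic.MonoidSolver using (solve)
open import Algebra.Properties.AbelianGroup +-0-abelianGroup using (∙-cancelʳ)

-- Levi's lemma. The overlap in the first alternative is non-empty, so equal cuts fall under the
-- second.
levi : ∀ {A : Set} (as cs : List A) {bs ds} → as ++ bs ≡ cs ++ ds →
       (∃[ x ] ∃[ m ] cs ≡ as ++ x ∷ m × bs ≡ (x ∷ m) ++ ds) ⊎
       (∃[ m ] as ≡ cs ++ m × ds ≡ m ++ bs)
levi []       []       e = inj₂ ([] , refl , sym e)
levi []       (c ∷ cs) e = inj₁ (c , cs , refl , e)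
levi (a ∷ as) []       e = inj₂ (a ∷ as , refl , sym e)
levi (a ∷ as) (c ∷ cs) e with refl , e′ ← ∷-injective e with levi as cs e′
... | inj₁ (x , m , p , q) = inj₁ (x , m , cong (a ∷_) p , q)
... | inj₂ (m , p , q)     = inj₂ (m , cong (a ∷_) p , q)

take-length-++ : ∀ {A : Set} (l r : List A) → take (length l) (l ++ r) ≡ l
take-length-++ []      r = refl
take-length-++ (x ∷ l) r = cong (x ∷_) (take-length-++ l r)

drop-length-++ : ∀ {A : Set} (l r : List A) → drop (length l) (l ++ r) ≡ r
drop-length-++ []      r = refl
drop-length-++ (x ∷ l) r = drop-length-++ l r

-- Turns a split into an index in `Fin n`, over which the finite checks can range.
split-at : ∀ {A : Set} n (xs l r : List A) → xs ≡ l ++ r → length l < n →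
           ∃[ i ] l ≡ take (toℕ {n} i) xs × r ≡ drop (toℕ {n} i) xs
split-at n _ l r refl l<n = fromℕ< l<n , at , dt
  where
  at : l ≡ take (toℕ (fromℕ< l<n)) (l ++ r)
  at rewrite toℕ-fromℕ< l<n = sym (take-length-++ l r)
  dt : r ≡ drop (toℕ (fromℕ< l<n)) (l ++ r)
  dt rewrite toℕ-fromℕ< l<n = sym (drop-length-++ l r)

length-prefix≤ : ∀ {A : Set} {xs : List A} l r → xs ≡ l ++ r → length l ≤ length xs
length-prefix≤ l r refl = subst (length l ≤_) (sym (length-++ l)) (ℕ.m≤m+n _ _)

-- Cutting images of words

after : Fin 4 → Fin 6 → Word 3
after a i = drop (toℕ i) (h₂ a)

-- `suffix` and `prefix` are never empty, `rest` may be: a word ending at a join belongs to the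
-- block on its left, one starting there to the block on its right.
suffix rest prefix : Fin 4 → Fin 5 → Word 3
suffix a i = after a (inject₁ i)
rest   a i = after a (suc i)
prefix a i = take (toℕ (suc i)) (h₂ a)

length-h₂ : ∀ a → length (h₂ a) ≡ 5
length-h₂ = from-yes (all? λ a → length (h₂ a) ℕ.≟ 5)

block-suffix : ∀ a l x r → h₂ a ≡ l ++ x ∷ r → ∃[ i ] x ∷ r ≡ suffix a i
block-suffix a l x r e =
  let i , _ , q = split-at 5 (h₂ a) l (x ∷ r) e l<5
  in  i , trans q (cong (λ n → drop n (h₂ a)) (sym (toℕ-inject₁ i)))
  where
  l<5 : length l < 5
  l<5 = subst (length l <_) (trans (sym (length-++ l)) (trans (cong length (sym e)) (length-h₂ a)))
              (ℕ.m<m+n (length l) (s≤s z≤n))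

block-prefix : ∀ a x l r → h₂ a ≡ (x ∷ l) ++ r → ∃[ i ] x ∷ l ≡ prefix a i × r ≡ rest a i
block-prefix a x l r e
  -- Six lengths, since the prefix may be the whole block; length 0 is excluded by `x`.
  with split-at 6 (h₂ a) (x ∷ l) r e (s≤s (subst (length (x ∷ l) ≤_) (length-h₂ a) (length-prefix≤ (x ∷ l) r e)))
... | suc i , p , q = i , p , q

cut-left : ∀ w l x r → apply h₂ w ≡ l ++ x ∷ r →
           ∃[ v ] ∃[ a ] ∃[ v′ ] ∃[ i ] w ≡ v ++ a ∷ v′ × suffix a i ++ apply h₂ v′ ≡ x ∷ r
cut-left [] l x r e with () ← ++-conicalʳ l (x ∷ r) (sym e)
cut-left (a ∷ w) l x r e with levi l (h₂ a) (sym e)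
... | inj₁ (y , m , p , q) with i , s ← block-suffix a l y m p =
  [] , a , w , i , refl , trans (cong (_++ apply h₂ w) (sym s)) (sym q)
... | inj₂ (m , _ , q) with v , b , v′ , i , s , t ← cut-left w m x r q =
  a ∷ v , b , v′ , i , cong (a ∷_) s , t

cut-right : ∀ w x l r → apply h₂ w ≡ (x ∷ l) ++ r →
            ∃[ v ] ∃[ a ] ∃[ v′ ] ∃[ i ] w ≡ v ++ a ∷ v′ ×
              x ∷ l ≡ apply h₂ v ++ prefix a i × r ≡ rest a i ++ apply h₂ v′
cut-right (a ∷ w) x l r e with levi (h₂ a) (x ∷ l) e
... | inj₁ (y , m , p , q) with v , b , v′ , i , s , t , u ← cut-right w y m r q =
  a ∷ v , b , v′ , i , cong (a ∷_) s ,
  trans p (trans (cong (h₂ a ++_) t) (sym (++-assoc (h₂ a) (apply h₂ v) _))) , u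
... | inj₂ (m , p , q) with i , s , t ← block-prefix a x l m p =
  [] , a , w , i , refl , s , trans q (cong (_++ apply h₂ w) t)

-- All images start with 0. Hence the 2-letter factor across a join does not depend on the block
-- that follows, which makes weights additive over blocks.
prefix-head : ∀ a i → ∃[ r ] prefix a i ≡ # 0 ∷ r
prefix-head zero                   i = _ , refl
prefix-head (suc zero)             i = _ , refl
prefix-head (suc (suc zero))       i = _ , refl
prefix-head (suc (suc (suc zero))) i = _ , refl

apply-head : ∀ v r → ∃[ r′ ] apply h₂ v ++ # 0 ∷ r ≡ # 0 ∷ r′
apply-head []                         r = _ , refl
apply-head (zero ∷ v)                 r = _ , refl
apply-head (suc zero ∷ v)             r = _ , refl
apply-head (suc (suc zero) ∷ v)       r = _ , refl
apply-head (suc (suc (suc zero)) ∷ v) r = _ , refl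

-- Counting

Functional : Set
Functional = List (ℤ × Fin 3 × Fin 3)

weight : Functional → Word 3 → ℤ
weight []                u = + 0
weight ((n , x , y) ∷ F) u = n * + occurrences u (x ∷ y ∷ []) + weight F u

weight-cong : ∀ F {u v} → AbelianEquivalent 2 u v → weight F u ≡ weight F v
weight-cong []                eq = refl
weight-cong ((n , x , y) ∷ F) eq =
  cong₂ (λ m k → n * + m + k) (eq (x ∷ y ∷ []) (λ ()) (s≤s (s≤s z≤n))) (weight-cong F eq)

occurrences-[x] : ∀ (x y z : Fin 3) → occurrences (x ∷ []) (y ∷ z ∷ []) ≡ 0
occurrences-[x] x y z with y ≟ᶠ x
... | yes _ = refl
... | no _  = refl

occurrences-∷∷ : ∀ (c d y z : Fin 3) s →
  occurrences (c ∷ d ∷ s) (y ∷ z ∷ []) ≡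
  occurrences (c ∷ d ∷ []) (y ∷ z ∷ []) ℕ.+ occurrences (d ∷ s) (y ∷ z ∷ [])
occurrences-∷∷ c d y z s with y ≟ᶠ c | z ≟ᶠ d | occurrences-[x] d y z
... | yes _ | yes _ | e = cong (λ n → ℕ.suc (n ℕ.+ occurrences (d ∷ s) (y ∷ z ∷ []))) (sym e)
... | yes _ | no _  | e = cong (ℕ._+ occurrences (d ∷ s) (y ∷ z ∷ [])) (sym e)
... | no _  | yes _ | e = cong (ℕ._+ occurrences (d ∷ s) (y ∷ z ∷ [])) (sym e)
... | no _  | no _  | e = cong (ℕ._+ occurrences (d ∷ s) (y ∷ z ∷ [])) (sym e)

-- The two pieces share the letter `x`, so each 2-letter factor lies in exactly one of them.
occurrences-overlap : ∀ s (x y z : Fin 3) r →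
  occurrences (s ++ x ∷ r) (y ∷ z ∷ []) ≡
  occurrences (s ∷ʳ x) (y ∷ z ∷ []) ℕ.+ occurrences (x ∷ r) (y ∷ z ∷ [])
occurrences-overlap [] x y z r =
  cong (ℕ._+ occurrences (x ∷ r) (y ∷ z ∷ [])) (sym (occurrences-[x] x y z))
occurrences-overlap (c ∷ []) x y z r = occurrences-∷∷ c x y z r
occurrences-overlap (c ∷ d ∷ s) x y z r = begin
  occurrences (c ∷ d ∷ s ++ x ∷ r) yz
    ≡⟨ occurrences-∷∷ c d y z (s ++ x ∷ r) ⟩
  occurrences (c ∷ d ∷ []) yz ℕ.+ occurrences (d ∷ s ++ x ∷ r) yz
    ≡⟨ cong (occurrences (c ∷ d ∷ []) yz ℕ.+_) (occurrences-overlap (d ∷ s) x y z r) ⟩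
  occurrences (c ∷ d ∷ []) yz ℕ.+ (occurrences (d ∷ s ∷ʳ x) yz ℕ.+ occurrences (x ∷ r) yz)
    ≡⟨ ℕ.+-assoc (occurrences (c ∷ d ∷ []) yz) _ _ ⟨
  occurrences (c ∷ d ∷ []) yz ℕ.+ occurrences (d ∷ s ∷ʳ x) yz ℕ.+ occurrences (x ∷ r) yz
    ≡⟨ cong (ℕ._+ occurrences (x ∷ r) yz) (occurrences-∷∷ c d y z (s ∷ʳ x)) ⟨
  occurrences (c ∷ d ∷ s ∷ʳ x) yz ℕ.+ occurrences (x ∷ r) yz ∎
  where
  open ≡-Reasoning
  yz : Word 3
  yz = y ∷ z ∷ []

weight-overlap : ∀ F s x r → weight F (s ++ x ∷ r) ≡ weight F (s ∷ʳ x) + weight F (x ∷ r)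
weight-overlap [] s x r = refl
weight-overlap ((n , y , z) ∷ F) s x r = begin
  n * + occurrences (s ++ x ∷ r) (y ∷ z ∷ []) + weight F (s ++ x ∷ r)
    ≡⟨ cong₂ (λ i j → n * i + j)
         (trans (cong +_ (occurrences-overlap s x y z r)) (pos-+ (occurrences (s ∷ʳ x) (y ∷ z ∷ [])) _))
         (weight-overlap F s x r) ⟩
  n * (+ occurrences (s ∷ʳ x) (y ∷ z ∷ []) + + occurrences (x ∷ r) (y ∷ z ∷ []))
    + (weight F (s ∷ʳ x) + weight F (x ∷ r))
    ≡⟨ rearrange n _ _ _ _ ⟩
  weight ((n , y , z) ∷ F) (s ∷ʳ x) + weight ((n , y , z) ∷ F) (x ∷ r) ∎
  where
  open ≡-Reasoning
  rearrange : ∀ n a b c d → n * (a + b) + (c + d) ≡ (n * a + c) + (n * b + d)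
  rearrange = solve-∀

-- Each block is weighed with the 0 that begins whatever follows, so the factor at the join is
-- counted once.
blockWeight : Functional → Word 4 → ℤ
blockWeight F []      = + 0
blockWeight F (a ∷ v) = weight F (h₂ a ∷ʳ # 0) + blockWeight F v

weight-blocks : ∀ F v r → weight F (apply h₂ v ++ # 0 ∷ r) ≡ blockWeight F v + weight F (# 0 ∷ r)
weight-blocks F [] r = sym (+-identityˡ _)
weight-blocks F (a ∷ v) r with r′ , e ← apply-head v r = begin
  weight F ((h₂ a ++ apply h₂ v) ++ # 0 ∷ r)
    ≡⟨ cong (weight F) (++-assoc (h₂ a) (apply h₂ v) _) ⟩
  weight F (h₂ a ++ apply h₂ v ++ # 0 ∷ r)
    ≡⟨ cong (λ u → weight F (h₂ a ++ u)) e ⟩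
  weight F (h₂ a ++ # 0 ∷ r′)
    ≡⟨ weight-overlap F (h₂ a) (# 0) r′ ⟩
  weight F (h₂ a ∷ʳ # 0) + weight F (# 0 ∷ r′)
    ≡⟨ cong (λ u → weight F (h₂ a ∷ʳ # 0) + weight F u) e ⟨
  weight F (h₂ a ∷ʳ # 0) + weight F (apply h₂ v ++ # 0 ∷ r)
    ≡⟨ cong (_+_ (weight F (h₂ a ∷ʳ # 0))) (weight-blocks F v r) ⟩
  weight F (h₂ a ∷ʳ # 0) + (blockWeight F v + weight F (# 0 ∷ r))
    ≡⟨ +-assoc (weight F (h₂ a ∷ʳ # 0)) _ _ ⟨
  blockWeight F (a ∷ v) + weight F (# 0 ∷ r) ∎
  where open ≡-Reasoning

-- `prefix a i` is non-empty and supplies the 0 that closes the last full block, or `s` if there is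
-- none.
weight-cut : ∀ F s v a i → weight F (s ++ apply h₂ v ++ prefix a i) ≡
             weight F (s ∷ʳ # 0) + (blockWeight F v + weight F (prefix a i))
weight-cut F s v a i with prefix a i | prefix-head a i
... | _ | r , refl with r′ , e ← apply-head v r = begin
  weight F (s ++ apply h₂ v ++ # 0 ∷ r)
    ≡⟨ cong (λ u → weight F (s ++ u)) e ⟩
  weight F (s ++ # 0 ∷ r′)
    ≡⟨ weight-overlap F s (# 0) r′ ⟩
  weight F (s ∷ʳ # 0) + weight F (# 0 ∷ r′)
    ≡⟨ cong (λ u → weight F (s ∷ʳ # 0) + weight F u) e ⟨
  weight F (s ∷ʳ # 0) + weight F (apply h₂ v ++ # 0 ∷ r)
    ≡⟨ cong (_+_ (weight F (s ∷ʳ # 0))) (weight-blocks F v r) ⟩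
  weight F (s ∷ʳ # 0) + (blockWeight F v + weight F (# 0 ∷ r)) ∎
  where open ≡-Reasoning

-- letter t counts, in h₂ v · 0, the occurrences of t in v; for instance
-- 01 occurs once in the images of 1, 2, 3 and 12 once in those of 2, 3.
letter : Fin 4 → Functional
letter zero                   = (+ 1 , # 0 , # 2) ∷ []
letter (suc zero)             = (+ 1 , # 0 , # 1) ∷ (-[1+ 0 ] , # 1 , # 2) ∷ []
letter (suc (suc zero))       = (+ 1 , # 1 , # 2) ∷ (-[1+ 0 ] , # 2 , # 2) ∷ []
letter (suc (suc (suc zero))) = (+ 1 , # 2 , # 2) ∷ []

-- A combination of the linear relations satisfied by the 2-letter factor
-- counts of every h₂ v · 0.  Its coefficients are chosen generically, so that it
-- rejects every boundary configuration incompatible with 2-abelian equivalence.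
relator : Functional
relator = (+ 4 , # 0 , # 0) ∷ (-[1+ 20 ] , # 0 , # 1) ∷ (-[1+ 6 ] , # 0 , # 2) ∷ (+ 1 , # 1 , # 0) ∷
          (+ 8 , # 1 , # 1) ∷ (+ 14 , # 1 , # 2) ∷ (-[1+ 1 ] , # 2 , # 1) ∷ (+ 8 , # 2 , # 2) ∷ []

-- Generic coefficients, separating the partial blocks compared below.
separator : Functional
separator = (+ 2 , # 0 , # 0) ∷ (+ 10 , # 0 , # 1) ∷ (+ 3 , # 0 , # 2) ∷ (+ 6 , # 1 , # 1) ∷
            (+ 4 , # 1 , # 2) ∷ (+ 1 , # 2 , # 1) ∷ (+ 4 , # 2 , # 2) ∷ []

count : Fin 4 → Word 4 → ℤ
count t v = + occurrences v (t ∷ [])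

occurrences-++ : ∀ {n} (u v : Word n) t →
  occurrences (u ++ v) (t ∷ []) ≡ occurrences u (t ∷ []) ℕ.+ occurrences v (t ∷ [])
occurrences-++ []      v t = refl
occurrences-++ (x ∷ u) v t with t ≟ᶠ x
... | yes _ = cong ℕ.suc (occurrences-++ u v t)
... | no _  = occurrences-++ u v t

count-++ : ∀ t u v → count t (u ++ v) ≡ count t u + count t v
count-++ t u v = trans (cong +_ (occurrences-++ u v t)) (pos-+ (occurrences u (t ∷ [])) _)

blockWeight-letter : ∀ t v → blockWeight (letter t) v ≡ count t v
blockWeight-letter t []      = refl
blockWeight-letter t (a ∷ v) =
  trans (cong₂ _+_ (block t a) (blockWeight-letter t v)) (sym (count-++ t (a ∷ []) v))
  where
  block : ∀ t a → weight (letter t) (h₂ a ∷ʳ # 0) ≡ count t (a ∷ [])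
  block = from-yes (all? λ t → all? λ a → weight (letter t) (h₂ a ∷ʳ # 0) ≟ count t (a ∷ []))

blockWeight-relator : ∀ v → blockWeight relator v ≡ + 0
blockWeight-relator []      = refl
blockWeight-relator (a ∷ v) = cong₂ _+_ (block a) (blockWeight-relator v)
  where
  block : ∀ a → weight relator (h₂ a ∷ʳ # 0) ≡ + 0
  block = from-yes (all? λ a → weight relator (h₂ a ∷ʳ # 0) ≟ + 0)

-- Boundary configurations

join : Functional → Word 3 → Word 3 → ℤ
join F s p = weight F (s ∷ʳ # 0) + weight F p

-- The side to which a boundary letter moves: index 0 puts it to the right of the cut, index 1 to
-- the left.
takeˡ dropˡ : Fin 2 → Fin 4 → Word 4
takeˡ n a = take (toℕ n) (a ∷ [])
dropˡ n a = drop (toℕ n) (a ∷ [])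

-- The last equation says that dropˡ α a · w₁ · takeˡ β b and dropˡ β b · w₂ · takeˡ γ c
-- contain t equally often, once the letter t weights of u₁ and u₂ are known to agree.
Boundary : Fin 4 → Fin 5 → Fin 4 → Fin 5 → Fin 4 → Fin 5 → Set
Boundary a i b j c k =
  join relator (suffix a i) (prefix b j) ≡ join relator (rest b j) (prefix c k) →
  ∃[ α ] ∃[ β ] ∃[ γ ] ∀ t →
    join (letter t) (suffix a i) (prefix b j) + (count t (dropˡ β b) + count t (takeˡ γ c)) ≡
    join (letter t) (rest b j) (prefix c k) + (count t (dropˡ α a) + count t (takeˡ β b))

boundary? : ∀ a i b j c k → Dec (Boundary a i b j c k)
boundary? a i b j c k =
  (_ ≟ _) →-dec any? λ α → any? λ β → any? λ γ → all? λ t → _ ≟ _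

-- Excludes squares inside one block. The length bound matters: single letters contain no 2-letter
-- factor, so all have weight 0.
Unequal : Fin 4 → Fin 5 → Fin 6 → Fin 6 → Set
Unequal a i m n = 2 ≤ length (take (toℕ m) (suffix a i)) →
  weight separator (take (toℕ m) (suffix a i)) ≢
  weight separator (take (toℕ n) (drop (toℕ m) (suffix a i)))

unequal? : ∀ a i m n → Dec (Unequal a i m n)
unequal? a i m n = (_ ≤? _) →-dec ¬? (_ ≟ _)

-- Serves squares centred at the join of the adjacent blocks of `a` and `c`; the conclusion yields
-- the square `a a` in the preimage.
Separated : Fin 4 → Fin 5 → Fin 4 → Fin 5 → Set
Separated a i c k = 2 ≤ length (suffix a i) →
  weight separator (suffix a i) ≡ weight separator (prefix c k) → a ≡ c

separated? : ∀ a i c k → Dec (Separated a i c k)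
separated? a i c k = (_ ≤? _) →-dec ((_ ≟ _) →-dec (a ≟ᶠ c))

-- Abstract, since unfolding a use of these proofs would repeat the finite check.
abstract
  boundary : ∀ a i b j c k → Boundary a i b j c k
  boundary = from-yes
    (all? λ a → all? λ i → all? λ b → all? λ j → all? λ c → all? λ k → boundary? a i b j c k)

  unequal : ∀ a i m n → Unequal a i m n
  unequal = from-yes (all? λ a → all? λ i → all? λ m → all? λ n → unequal? a i m n)

  separated : ∀ a i c k → Separated a i c k
  separated = from-yes (all? λ a → all? λ i → all? λ c → all? λ k → separated? a i c k)

-- Joins of blocks

joins : Word 3 → ℕ
joins u = occurrences u (# 1 ∷ # 0 ∷ [])

joins-within-block : ∀ a i n → joins (take (toℕ {6} n) (after a i)) ≡ 0
joins-within-block = from-yes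
  (all? λ a → all? λ i → all? λ n → joins (take (toℕ {6} n) (after a i)) ℕ.≟ 0)

joins-suffix : ∀ a i → joins (suffix a i ∷ʳ # 0) ≡ 1
joins-suffix = from-yes (all? λ a → all? λ i → joins (suffix a i ∷ʳ # 0) ℕ.≟ 1)

-- All images end in 1 and begin with 0, so the first join crossed already contributes a factor 10.
joins-crossing : ∀ a i v c k → joins (suffix a i ++ apply h₂ v ++ prefix c k) ≢ 0
joins-crossing a i v c k e with prefix c k | prefix-head c k
... | _ | r , refl with apply h₂ v ++ # 0 ∷ r | apply-head v r
... | _ | r′ , refl
  with () ← trans (sym (trans (occurrences-overlap (suffix a i) (# 0) (# 1) (# 0) r′)
                              (cong (ℕ._+ joins (# 0 ∷ r′)) (joins-suffix a i)))) e

length-after<6 : ∀ a i → length (after a i) < 6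
length-after<6 = from-yes (all? λ a → all? λ i → length (after a i) ℕ.<? 6)

joins-prefix-after : ∀ a i u r → after a i ≡ u ++ r → joins u ≡ 0
joins-prefix-after a i u r e
  with n , p , _ ← split-at 6 (after a i) u r e (ℕ.≤-<-trans (length-prefix≤ u r e) (length-after<6 a i)) =
  trans (cong joins p) (joins-within-block a i n)

joins-cong : ∀ {u v} → AbelianEquivalent 2 u v → joins u ≡ joins v
joins-cong eq = eq (# 1 ∷ # 0 ∷ []) (λ ()) (s≤s (s≤s z≤n))

no-square-within-suffix : ∀ a i u₁ u₂ r → suffix a i ≡ u₁ ++ u₂ ++ r →
                          2 ≤ length u₁ → AbelianEquivalent 2 u₁ u₂ → ⊥
no-square-within-suffix a i u₁ u₂ r e 2≤ eq =
  let m , p , q  = split-at 6 S u₁ (u₂ ++ r) e (ℕ.≤-<-trans (length-prefix≤ u₁ (u₂ ++ r) e) S<6)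
      n , p′ , _ = split-at 6 (drop (toℕ m) S) u₂ r (sym q)
                     (ℕ.≤-<-trans (length-prefix≤ u₂ r (sym q)) (ℕ.≤-<-trans (length-drop≤ (toℕ m)) S<6))
  in  unequal a i m n (subst (λ u → 2 ≤ length u) p 2≤)
        (subst₂ (λ u v → weight separator u ≡ weight separator v) p p′ (weight-cong separator eq))
  where
  S : Word 3
  S = suffix a i
  S<6 : length S < 6
  S<6 = length-after<6 a (inject₁ i)
  length-drop≤ : ∀ m → length (drop m S) ≤ length S
  length-drop≤ m = subst (_≤ length S) (sym (length-drop m S)) (ℕ.m∸n≤m (length S) m)

-- Squares in the preimage

square⇒⊥ : ∀ {w} → AbelianSquareFree w → ∀ x (l r : Word 4) y → w ≡ x ++ (l ++ r) ++ y →
           l ++ r ≢ [] → (∀ t → count t l ≡ count t r) → ⊥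
square⇒⊥ free x l r y refl nonEmpty eq =
  free (l ++ r) (fromView (MkView x (Pointwise-refl refl) y))
    record { u₁ = l ; u₂ = r ; split = refl ; nonEmpty = nonEmpty ; equivalent = equivalent }
  where
  equivalent : AbelianEquivalent 1 l r
  equivalent []          ne _ = contradiction refl ne
  equivalent (t ∷ [])    _  _ = +-injective (eq t)
  equivalent (_ ∷ _ ∷ _) _ (s≤s ())

-- Full blocks have relator weight 0, so only the partial blocks remain; comparing `u₁` with `u₂`
-- gives the premise of `Boundary`.
relator-cut : ∀ s v a i → weight relator (s ++ apply h₂ v ++ prefix a i) ≡ join relator s (prefix a i)
relator-cut s v a i = trans (weight-cut relator s v a i)
  (cong (_+_ (weight relator (s ∷ʳ # 0)))
    (trans (cong (_+ weight relator (prefix a i)) (blockWeight-relator v)) (+-identityˡ _)))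

letter-cut : ∀ t s v a i → weight (letter t) (s ++ apply h₂ v ++ prefix a i) ≡
             weight (letter t) (s ∷ʳ # 0) + (count t v + weight (letter t) (prefix a i))
letter-cut t s v a i = trans (weight-cut (letter t) s v a i)
  (cong (λ n → weight (letter t) (s ∷ʳ # 0) + (n + weight (letter t) (prefix a i))) (blockWeight-letter t v))

-- `e` will be the equality of the `letter` weights of `u₁` and `u₂`, and `f` the equation supplied
-- by `Boundary`. Adding them crosswise leaves a common summand to cancel.
transfer : ∀ s x p s′ y q A B B′ C → s + (x + p) ≡ s′ + (y + q) →
           (s + p) + (B + C) ≡ (s′ + q) + (A + B′) → A + (x + B′) ≡ B + (y + C)
transfer s x p s′ y q A B B′ C e f = ∙-cancelʳ ((s′ + q) + (s + p)) _ _ (begin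
  A + (x + B′) + ((s′ + q) + (s + p))     ≡⟨ left A x B′ s′ q s p ⟩
  ((s′ + q) + (A + B′)) + (s + (x + p))   ≡⟨ cong₂ _+_ (sym f) e ⟩
  ((s + p) + (B + C)) + (s′ + (y + q))    ≡⟨ right s p B C s′ y q ⟩
  B + (y + C) + ((s′ + q) + (s + p))      ∎)
  where
  open ≡-Reasoning
  left : ∀ A x B′ s′ q s p → A + (x + B′) + ((s′ + q) + (s + p)) ≡ ((s′ + q) + (A + B′)) + (s + (x + p))
  left = solve-∀
  right : ∀ s p B C s′ y q → ((s + p) + (B + C)) + (s′ + (y + q)) ≡ B + (y + C) + ((s′ + q) + (s + p))
  right = solve-∀

count-++₃ : ∀ t u v x → count t (u ++ v ++ x) ≡ count t u + (count t v + count t x)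
count-++₃ t u v x = trans (count-++ t u (v ++ x)) (cong (_+_ (count t u)) (count-++ t v x))

divide : ∀ n a (v : Word 4) → a ∷ v ≡ takeˡ n a ++ dropˡ n a ++ v
divide zero       a v = refl
divide (suc zero) a v = refl

regroup : ∀ (v A₁ A₂ w₁ B₁ B₂ w₂ C₁ C₂ w₃ : Word 4) →
  v ++ A₁ ++ A₂ ++ w₁ ++ B₁ ++ B₂ ++ w₂ ++ C₁ ++ C₂ ++ w₃ ≡
  (v ++ A₁) ++ ((A₂ ++ w₁ ++ B₁) ++ (B₂ ++ w₂ ++ C₁)) ++ (C₂ ++ w₃)
regroup v A₁ A₂ w₁ B₁ B₂ w₂ C₁ C₂ w₃ = solve (++-monoid (Fin 4))

-- The finite check puts `a` into the left half or discards it, `b` into one of the halves, and `c`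
-- into the right half or discards it, so that the halves get equal Parikh vectors.
no-long-square : ∀ {w} → AbelianSquareFree w → ∀ v a i w₁ b j w₂ c k w₃ →
  w ≡ v ++ a ∷ w₁ ++ b ∷ w₂ ++ c ∷ w₃ →
  AbelianEquivalent 2 (suffix a i ++ apply h₂ w₁ ++ prefix b j) (rest b j ++ apply h₂ w₂ ++ prefix c k) → ⊥
no-long-square {w} free v a i w₁ b j w₂ c k w₃ e eq =
  let α , β , γ , parikh = boundary a i b j c k
        (trans (sym (relator-cut (suffix a i) w₁ b j))
               (trans (weight-cong relator eq) (relator-cut (rest b j) w₂ c k)))
  in  square⇒⊥ free (v ++ takeˡ α a) (left α β) (right β γ) (dropˡ γ c ++ w₃)
        (factor α β γ) (nonEmpty α β γ) (λ t → counts α β γ t (parikh t))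
  where
  left right : Fin 2 → Fin 2 → Word 4
  left  α β = dropˡ α a ++ w₁ ++ takeˡ β b
  right β γ = dropˡ β b ++ w₂ ++ takeˡ γ c

  factor : ∀ α β γ → w ≡ (v ++ takeˡ α a) ++ (left α β ++ right β γ) ++ dropˡ γ c ++ w₃
  factor α β γ = begin
    w
      ≡⟨ e ⟩
    v ++ a ∷ w₁ ++ b ∷ w₂ ++ c ∷ w₃
      ≡⟨ cong (λ u → v ++ a ∷ w₁ ++ b ∷ w₂ ++ u) (divide γ c w₃) ⟩
    v ++ a ∷ w₁ ++ b ∷ w₂ ++ takeˡ γ c ++ dropˡ γ c ++ w₃
      ≡⟨ cong (λ u → v ++ a ∷ w₁ ++ u) (divide β b _) ⟩
    v ++ a ∷ w₁ ++ takeˡ β b ++ dropˡ β b ++ w₂ ++ takeˡ γ c ++ dropˡ γ c ++ w₃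
      ≡⟨ cong (v ++_) (divide α a _) ⟩
    v ++ takeˡ α a ++ dropˡ α a ++ w₁ ++ takeˡ β b ++ dropˡ β b ++ w₂ ++ takeˡ γ c ++ dropˡ γ c ++ w₃
      ≡⟨ regroup v (takeˡ α a) (dropˡ α a) w₁ (takeˡ β b) (dropˡ β b) w₂ (takeˡ γ c) (dropˡ γ c) w₃ ⟩
    (v ++ takeˡ α a) ++ (left α β ++ right β γ) ++ dropˡ γ c ++ w₃ ∎
    where open ≡-Reasoning

  -- The letter `b` lies in one of the halves, whatever `β` is.
  nonEmpty : ∀ α β γ → left α β ++ right β γ ≢ []
  nonEmpty α zero γ l≡[] with () ← ++-conicalʳ (left α zero) _ l≡[]
  nonEmpty α (suc zero) γ l≡[]
    with () ← ++-conicalʳ w₁ _ (++-conicalʳ (dropˡ α a) _ (++-conicalˡ (left α (suc zero)) _ l≡[]))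

  counts : ∀ α β γ t →
    join (letter t) (suffix a i) (prefix b j) + (count t (dropˡ β b) + count t (takeˡ γ c)) ≡
    join (letter t) (rest b j) (prefix c k) + (count t (dropˡ α a) + count t (takeˡ β b)) →
    count t (left α β) ≡ count t (right β γ)
  counts α β γ t parikh = begin
    count t (left α β)
      ≡⟨ count-++₃ t (dropˡ α a) w₁ (takeˡ β b) ⟩
    count t (dropˡ α a) + (count t w₁ + count t (takeˡ β b))
      ≡⟨ transfer (weight (letter t) (suffix a i ∷ʳ # 0)) (count t w₁) (weight (letter t) (prefix b j))
           (weight (letter t) (rest b j ∷ʳ # 0)) (count t w₂) (weight (letter t) (prefix c k))
           (count t (dropˡ α a)) (count t (dropˡ β b)) (count t (takeˡ β b)) (count t (takeˡ γ c))
           (trans (sym (letter-cut t (suffix a i) w₁ b j))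
                  (trans (weight-cong (letter t) eq) (letter-cut t (rest b j) w₂ c k)))
           parikh ⟩
    count t (dropˡ β b) + (count t w₂ + count t (takeˡ γ c))
      ≡⟨ count-++₃ t (dropˡ β b) w₂ (takeˡ γ c) ⟨
    count t (right β γ) ∎
    where open ≡-Reasoning

-- Since u₁ meets no join, neither does u₂, so u₁ is a suffix of a block and u₂ a prefix of the next.
no-square-from-suffix : ∀ {w} → AbelianSquareFree w → ∀ v a i w₁ c k w₂ u₁ m →
  w ≡ v ++ a ∷ w₁ ++ c ∷ w₂ → suffix a i ≡ u₁ ++ m → 2 ≤ length u₁ →
  AbelianEquivalent 2 u₁ (m ++ apply h₂ w₁ ++ prefix c k) → ⊥
no-square-from-suffix free v a i w₁ c k w₂ u₁ (x ∷ m) _ s _ eq =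
  -- `x ∷ m` is what `u₁` leaves of the block `a`; `u₂` starts with it and then crosses a join,
  -- whereas `u₁` crosses none.
  let j , p = block-suffix a (take (toℕ (inject₁ i)) (h₂ a) ++ u₁) x m
                (trans (sym (take++drop≡id (toℕ (inject₁ i)) (h₂ a)))
                  (trans (cong (take (toℕ (inject₁ i)) (h₂ a) ++_) s)
                         (sym (++-assoc (take (toℕ (inject₁ i)) (h₂ a)) u₁ (x ∷ m)))))
  in  joins-crossing a j w₁ c k
        (trans (cong (λ u → joins (u ++ apply h₂ w₁ ++ prefix c k)) (sym p))
               (trans (sym (joins-cong eq)) (joins-prefix-after a (inject₁ i) u₁ (x ∷ m) s)))
no-square-from-suffix free v a i (d ∷ w₁) c k w₂ u₁ [] _ s _ eq =
  -- `suffix d zero` is the whole image of `d`, and `u₂` crosses the join after it.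
  joins-crossing d zero w₁ c k
    (trans (cong joins (sym (++-assoc (h₂ d) (apply h₂ w₁) (prefix c k))))
           (trans (sym (joins-cong eq)) (joins-prefix-after a (inject₁ i) u₁ [] s)))
no-square-from-suffix free v a i [] c k w₂ u₁ [] e s 2≤ eq
  with refl ← trans s (++-identityʳ u₁)
  with refl ← separated a i c k 2≤ (weight-cong separator eq) =
  square⇒⊥ free v (a ∷ []) (a ∷ []) w₂ e (λ ()) (λ _ → refl)

-- The cases are whether `u₁` runs past the block in which it starts, and whether `u₂` runs past the
-- block in which `u₁` ends.
no-square : ∀ {w} → AbelianSquareFree w → ∀ l u₁ u₂ r → apply h₂ w ≡ l ++ u₁ ++ u₂ ++ r →
            2 ≤ length u₁ → AbelianEquivalent 2 u₁ u₂ → ⊥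
no-square {w} free l u₁@(x ∷ u₁′) u₂ r e 2≤ eq
  with v , a , w′ , i , refl , e₁ ← cut-left w l x (u₁′ ++ u₂ ++ r) e
  with levi (suffix a i) u₁ e₁
... | inj₂ (m , s , e₂) with levi m u₂ (sym e₂)
...   | inj₂ (m′ , refl , _) = no-square-within-suffix a i u₁ u₂ m′ s 2≤ eq
...   | inj₁ (y , m′ , refl , e₃)
        with w₁ , c , w₂ , k , refl , p , _ ← cut-right w′ y m′ r e₃ =
  no-square-from-suffix free v a i w₁ c k w₂ u₁ m refl s 2≤
    (subst (λ u → AbelianEquivalent 2 u₁ (m ++ u)) p eq)
no-square {w} free l u₁@(x ∷ u₁′) u₂ r e 2≤ eq
    | inj₁ (y , m , s , e₂)
      with w₁ , b , w₂ , j , refl , p , q ← cut-right w′ y m (u₂ ++ r) e₂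
      with levi (rest b j) u₂ (sym q)
-- `u₂` stays within the block `b` and meets no join, yet `u₁` has crossed one.
...   | inj₂ (m′ , s′ , _) =
  joins-crossing a i w₁ b j
    (trans (cong joins (trans (cong (suffix a i ++_) (sym p)) (sym s)))
           (trans (joins-cong eq) (joins-prefix-after b (suc j) u₂ m′ s′)))
...   | inj₁ (z , m′ , s′ , e₃)
        with w₃ , c , w₄ , k , refl , p′ , _ ← cut-right w₂ z m′ r e₃ =
  no-long-square free v a i w₁ b j w₃ c k w₄ refl
    (subst₂ (AbelianEquivalent 2) (trans s (cong (suffix a i ++_) p)) (trans s′ (cong (rest b j ++_) p′)) eq)

theorem2 : AbelianSquareFreeMorphism 2 2 h₂
theorem2 w free s s⊑hw sq 2≤ = go (toView s⊑hw) refl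
  where
  open AbelianSquare sq
  go : ∀ {u} → View _≡_ s u → apply h₂ w ≡ u → ⊥
  go (MkView l s≋s′ r) e with refl ← Pointwise-≡⇒≡ s≋s′ =
    no-square free l u₁ u₂ r
      (trans e (cong (l ++_) (trans (cong (_++ r) split) (++-assoc u₁ u₂ r)))) 2≤ equivalent
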